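{- (a) QHC is a strongly conservative extension of classical predicate calculus QC: if $p_1,\dots,p_n\vdash_{\mathrm{QHC}} p$ where $p_1,\dots,p_n,p$ are propositions built from atomic propositions and $0$ using only classical connectives and quantifiers (no $!$, $?$), then $p_1,\dots,p_n\vdash_{\mathrm{QC}} p$. (b) QHC is a strongly conservative extension of QS4 via $\Box\mapsto ?!$: if $A_1,\dots,A_n, A$ are formulas of QS4 and the rule $A_1^*,\dots,A_n^*\,/\,A^*$ is derivable in QHC, where $B^*$ denotes the result of replacing every $\Box$ in $B$ by $?!$, then $A_1,\dots,A_n\vdash_{\mathrm{QS4}} A$.
   Context: QHC is a two-sorted first-order calculus. Its only terms are individual variables. Every formula is either a problem (denoted by Greek letters $\alpha,\beta,\gamma,\dots$) or a proposition (denoted by Latin letters $p,q,\dots$). Atomic formulas are proposition variables $p(t_1,\dots,t_n)$ (of proposition type), problem variables $\pi(t_1,\dots,t_n)$ (of problem type), and the constants $0$ (a proposition, classical falsity) and $\bot$ (a problem, intuitionistic absurdity). Propositions are closed under the classical connectives $\land,\lor,\to$ and quantifiers $\exists,\forall$; problems are closed under the intuitionistic connectives $\land,\lor,\to$ and quantifiers $\exists,\forall$ (the same symbols are used, distinguished by the type of the arguments). $\neg p$ abbreviates $p\to 0$, $\neg\alpha$ abbreviates $\alpha\to\bot$, and $\leftrightarrow$ is defined as usual. There are two type-conversion operators: if $p$ is a proposition then $!p$ is a problem, and if $\alpha$ is a problem then $?\alpha$ is a proposition. Deductive system of QHC: all axioms and rules of classical predicate logic applied to all propositions; all postulates and rules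 of intuitionistic predicate logic applied to all problems; the rules $p\,/\,!p$ and $\alpha\,/\,?\alpha$; and the schemas $?!p\to p$; $\alpha\to\, !?\alpha$; $!(p\to q)\to(!p\to !q)$; $?(\alpha\to\beta)\to(?\alpha\to ?\beta)$; $!0\to\bot$; $?(\alpha\land\beta)\leftrightarrow ?\alpha\land ?\beta$; $?(\alpha\lor\beta)\leftrightarrow ?\alpha\lor ?\beta$; $?\bot\to 0$; $?\exists x\,\alpha(x)\leftrightarrow\exists x\,?\alpha(x)$; $?\forall x\,\alpha(x)\to\forall x\,?\alpha(x)$ (usual variable side conditions implicit). $\vdash A$ means $A$ is derivable in QHC; $A\Rightarrow B$ means $\vdash A\to B$ and $A\Leftrightarrow B$ means $\vdash A\leftrightarrow B$ (with $A,B$ of the same type); $A\vdash B$ means $B$ is derivable in QHC from the premise $A$. Notation: $\Box p := ?!p$ (a proposition) and $\nabla\alpha := !?\alpha$ (a problem). QC and QH denote classical and intuitionistic predicate calculus. QS4 is classical predicate calculus (over the proposition variables of QHC) with a unary connective $\Box$, axiom schemes $\Box p\to p$, $\Box p\to\Box\Box p$, $\Box(p\to q)\to(\Box p\to\Box q)$ and rule $p\,/\,\Box p$. -}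

module Defs where

open import Data.Bool using (if_then_else_)
open import Data.Empty using (⊥)
open import Data.List using (List; map)
open import Data.List.Membership.Propositional using (_∈_)
open import Data.Nat using (ℕ; _≟_)
open import Data.Product using (_×_; _,_; ∃)
open import Data.Sum using (_⊎_)
open import Data.Unit using (⊤)
open import Data.Vec using (Vec)
import Data.Vec as Vec
import Data.Vec.Membership.Propositional as Vec
open import Relation.Binary.PropositionalEquality using (_≢_)
open import Relation.Nullary using (¬_; does)

Var : Set
Var = ℕ

data Sort : Set where
  proposition problem : Sort

-- The languages of QC and QS4, and the two sorts of QHC-formulas.
data Lang : Set where
  qc qs4 : Lang
  qhc    : Sort → Lang

infixl 35 _[_/_]
infixr 30 !_ ¿_ □_ ~_
infixr 25 ∀[_]_ ∃[_]_
infixr 22 _∧_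
infixr 21 _∨_
infixr 20 _⊃_
infix  19 _⇔_

-- The predicate connectives are common to all languages.
-- `atom {n = n} i xs` is the i-th n-ary predicate variable applied to xs: a
-- problem variable in the language `qhc problem`, a proposition variable in
-- the others.  `falsum` is ⊥ in `qhc problem` and 0 in the others.
-- `¿_` is the operator written ? on paper (a lone ? is a hole in Agda).
data Formula : Lang → Set where
  atom   : ∀ {L n} → ℕ → Vec Var n → Formula L
  falsum : ∀ {L} → Formula L
  _∧_    : ∀ {L} → Formula L → Formula L → Formula L
  _∨_    : ∀ {L} → Formula L → Formula L → Formula L
  _⊃_    : ∀ {L} → Formula L → Formula L → Formula L
  ∀[_]_  : ∀ {L} → Var → Formula L → Formula L
  ∃[_]_  : ∀ {L} → Var → Formula L → Formula L
  □_     : Formula qs4 → Formula qs4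
  !_     : Formula (qhc proposition) → Formula (qhc problem)
  ¿_     : Formula (qhc problem) → Formula (qhc proposition)

Proposition Problem : Set
Proposition = Formula (qhc proposition)
Problem     = Formula (qhc problem)

~_ : ∀ {L} → Formula L → Formula L
~ A = A ⊃ falsum

_⇔_ : ∀ {L} → Formula L → Formula L → Formula L
A ⇔ B = (A ⊃ B) ∧ (B ⊃ A)

Free : ∀ {L} → Var → Formula L → Set
Free x (atom _ ys) = x Vec.∈ ys
Free x falsum      = ⊥
Free x (A ∧ B)     = Free x A ⊎ Free x B
Free x (A ∨ B)     = Free x A ⊎ Free x B
Free x (A ⊃ B)     = Free x A ⊎ Free x B
Free x (∀[ z ] A)  = x ≢ z × Free x A
Free x (∃[ z ] A)  = x ≢ z × Free x A
Free x (□ A)       = Free x A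
Free x (! A)       = Free x A
Free x (¿ A)       = Free x A

-- A [ y / x ] replaces all free occurrences of x by y, without renaming bound
-- variables; it is the intended substitution only when FreeFor y x A holds.
_[_/_] : ∀ {L} → Formula L → Var → Var → Formula L
atom i zs  [ y / x ] = atom i (Vec.map (λ z → if does (z ≟ x) then y else z) zs)
falsum     [ y / x ] = falsum
(A ∧ B)    [ y / x ] = A [ y / x ] ∧ B [ y / x ]
(A ∨ B)    [ y / x ] = A [ y / x ] ∨ B [ y / x ]
(A ⊃ B)    [ y / x ] = A [ y / x ] ⊃ B [ y / x ]
(∀[ z ] A) [ y / x ] = ∀[ z ] (if does (z ≟ x) then A else A [ y / x ])
(∃[ z ] A) [ y / x ] = ∃[ z ] (if does (z ≟ x) then A else A [ y / x ])
(□ A)      [ y / x ] = □ (A [ y / x ])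
(! A)      [ y / x ] = ! (A [ y / x ])
(¿ A)      [ y / x ] = ¿ (A [ y / x ])

-- y is free for x: no free occurrence of x lies in the scope of a quantifier
-- binding y.
FreeFor : ∀ {L} → Var → Var → Formula L → Set
FreeFor y x (atom _ _)  = ⊤
FreeFor y x falsum      = ⊤
FreeFor y x (A ∧ B)     = FreeFor y x A × FreeFor y x B
FreeFor y x (A ∨ B)     = FreeFor y x A × FreeFor y x B
FreeFor y x (A ⊃ B)     = FreeFor y x A × FreeFor y x B
FreeFor y x (∀[ z ] A)  = ¬ Free x (∀[ z ] A) ⊎ (y ≢ z × FreeFor y x A)
FreeFor y x (∃[ z ] A)  = ¬ Free x (∃[ z ] A) ⊎ (y ≢ z × FreeFor y x A)
FreeFor y x (□ A)       = FreeFor y x A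
FreeFor y x (! A)       = FreeFor y x A
FreeFor y x (¿ A)       = FreeFor y x A

data IntuitionisticAxiom {L : Lang} : Formula L → Set where
  ⊃-K    : ∀ {A B}   → IntuitionisticAxiom (A ⊃ B ⊃ A)
  ⊃-S    : ∀ {A B C} → IntuitionisticAxiom ((A ⊃ B ⊃ C) ⊃ (A ⊃ B) ⊃ A ⊃ C)
  ∧-I    : ∀ {A B}   → IntuitionisticAxiom (A ⊃ B ⊃ A ∧ B)
  ∧-E₁   : ∀ {A B}   → IntuitionisticAxiom (A ∧ B ⊃ A)
  ∧-E₂   : ∀ {A B}   → IntuitionisticAxiom (A ∧ B ⊃ B)
  ∨-I₁   : ∀ {A B}   → IntuitionisticAxiom (A ⊃ A ∨ B)
  ∨-I₂   : ∀ {A B}   → IntuitionisticAxiom (B ⊃ A ∨ B)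
  ∨-E    : ∀ {A B C} → IntuitionisticAxiom ((A ⊃ C) ⊃ (B ⊃ C) ⊃ A ∨ B ⊃ C)
  ⊥-E    : ∀ {A}     → IntuitionisticAxiom (falsum ⊃ A)
  ∀-E    : ∀ {A x y} → FreeFor y x A → IntuitionisticAxiom ((∀[ x ] A) ⊃ A [ y / x ])
  ∃-I    : ∀ {A x y} → FreeFor y x A → IntuitionisticAxiom (A [ y / x ] ⊃ (∃[ x ] A))

data ClassicalAxiom {L : Lang} : Formula L → Set where
  int : ∀ {A} → IntuitionisticAxiom A → ClassicalAxiom A
  lem : ∀ {A} → ClassicalAxiom (A ∨ ~ A)

-- In the three calculi below, every rule applies to arbitrary formulas derived
-- from the premises Γ; in particular the quantifier rules may bind variables
-- that are free in Γ.

infix 4 _⊢QC_ _⊢QS4_ _⊢QHC_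

data _⊢QC_ (Γ : List (Formula qc)) : Formula qc → Set where
  premise : ∀ {A}     → A ∈ Γ → Γ ⊢QC A
  axiom   : ∀ {A}     → ClassicalAxiom A → Γ ⊢QC A
  mp      : ∀ {A B}   → Γ ⊢QC A ⊃ B → Γ ⊢QC A → Γ ⊢QC B
  ∀-intro : ∀ {A B x} → ¬ Free x A → Γ ⊢QC A ⊃ B → Γ ⊢QC A ⊃ (∀[ x ] B)
  ∃-elim  : ∀ {A B x} → ¬ Free x B → Γ ⊢QC A ⊃ B → Γ ⊢QC (∃[ x ] A) ⊃ B

data _⊢QS4_ (Γ : List (Formula qs4)) : Formula qs4 → Set where
  premise : ∀ {A}     → A ∈ Γ → Γ ⊢QS4 A
  axiom   : ∀ {A}     → ClassicalAxiom A → Γ ⊢QS4 A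
  mp      : ∀ {A B}   → Γ ⊢QS4 A ⊃ B → Γ ⊢QS4 A → Γ ⊢QS4 B
  ∀-intro : ∀ {A B x} → ¬ Free x A → Γ ⊢QS4 A ⊃ B → Γ ⊢QS4 A ⊃ (∀[ x ] B)
  ∃-elim  : ∀ {A B x} → ¬ Free x B → Γ ⊢QS4 A ⊃ B → Γ ⊢QS4 (∃[ x ] A) ⊃ B
  □-T     : ∀ {p}     → Γ ⊢QS4 □ p ⊃ p
  □-4     : ∀ {p}     → Γ ⊢QS4 □ p ⊃ □ □ p
  □-K     : ∀ {p q}   → Γ ⊢QS4 □ (p ⊃ q) ⊃ □ p ⊃ □ q
  nec     : ∀ {p}     → Γ ⊢QS4 p → Γ ⊢QS4 □ p

QHCAxiom : ∀ {s} → Formula (qhc s) → Set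
QHCAxiom {proposition} = ClassicalAxiom
QHCAxiom {problem}     = IntuitionisticAxiom

data _⊢QHC_ (Γ : List (∃ λ s → Formula (qhc s))) : ∀ {s} → Formula (qhc s) → Set where
  premise : ∀ {s} {A : Formula (qhc s)} → (s , A) ∈ Γ → Γ ⊢QHC A
  axiom   : ∀ {s} {A : Formula (qhc s)} → QHCAxiom A → Γ ⊢QHC A
  mp      : ∀ {s} {A B : Formula (qhc s)} → Γ ⊢QHC A ⊃ B → Γ ⊢QHC A → Γ ⊢QHC B
  ∀-intro : ∀ {s} {A B : Formula (qhc s)} {x} → ¬ Free x A →
            Γ ⊢QHC A ⊃ B → Γ ⊢QHC A ⊃ (∀[ x ] B)
  ∃-elim  : ∀ {s} {A B : Formula (qhc s)} {x} → ¬ Free x B →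
            Γ ⊢QHC A ⊃ B → Γ ⊢QHC (∃[ x ] A) ⊃ B
  !-rule  : ∀ {p : Proposition} → Γ ⊢QHC p → Γ ⊢QHC ! p
  ?-rule  : ∀ {α : Problem} → Γ ⊢QHC α → Γ ⊢QHC ¿ α
  ?!-E    : ∀ {p : Proposition} → Γ ⊢QHC ¿ ! p ⊃ p
  !?-I    : ∀ {α : Problem} → Γ ⊢QHC α ⊃ ! ¿ α
  !-⊃     : ∀ {p q : Proposition} → Γ ⊢QHC ! (p ⊃ q) ⊃ ! p ⊃ ! q
  ?-⊃     : ∀ {α β : Problem} → Γ ⊢QHC ¿ (α ⊃ β) ⊃ ¿ α ⊃ ¿ β
  !-0     : Γ ⊢QHC ! falsum ⊃ falsum
  ?-∧     : ∀ {α β : Problem} → Γ ⊢QHC ¿ (α ∧ β) ⇔ ¿ α ∧ ¿ β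
  ?-∨     : ∀ {α β : Problem} → Γ ⊢QHC ¿ (α ∨ β) ⇔ ¿ α ∨ ¿ β
  ?-⊥     : Γ ⊢QHC ¿ falsum ⊃ falsum
  ?-∃     : ∀ {x} {α : Problem} → Γ ⊢QHC ¿ (∃[ x ] α) ⇔ (∃[ x ] ¿ α)
  ?-∀     : ∀ {x} {α : Problem} → Γ ⊢QHC ¿ (∀[ x ] α) ⊃ (∀[ x ] ¿ α)

propositions : List Proposition → List (∃ λ s → Formula (qhc s))
propositions = map (proposition ,_)

infix 35 _° _*

-- Its image consists of the propositions containing neither ! nor ?.
_° : Formula qc → Proposition
atom i xs  ° = atom i xs
falsum     ° = falsum
(A ∧ B)    ° = A ° ∧ B °
(A ∨ B)    ° = A ° ∨ B °
(A ⊃ B)    ° = A ° ⊃ B °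
(∀[ x ] A) ° = ∀[ x ] A °
(∃[ x ] A) ° = ∃[ x ] A °

_* : Formula qs4 → Proposition
atom i xs  * = atom i xs
falsum     * = falsum
(A ∧ B)    * = A * ∧ B *
(A ∨ B)    * = A * ∨ B *
(A ⊃ B)    * = A * ⊃ B *
(∀[ x ] A) * = ∀[ x ] A *
(∃[ x ] A) * = ∃[ x ] A *
(□ A)      * = ¿ ! (A *)

{-# OPTIONS --safe #-}
-- Gödel's translation extends to QHC: propositions are read homomorphically,
-- problems are read as formulas A with A → □A (implications, universal
-- quantifications and problem variables being boxed), ! is read as □ and ? as
-- the identity.  It is sound for QHC and undoes B ↦ B *, which gives (b).
-- Nothing but the S4 laws of □ is used, and QC satisfies them when □ is read as
-- the identity, which gives (a).
module Submission where

open import Data.Bool using (if_then_else_; true; false)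
open import Data.Bool.Properties using (if-float)
open import Data.List using (List; map)
open import Data.List.Membership.Propositional using (_∈_)
open import Data.List.Membership.Propositional.Properties using (∈-map⁻)
open import Data.Nat using (_≟_)
open import Data.Product using (_×_; _,_)
import Data.Product as Product
open import Data.Sum using (inj₁; inj₂)
import Data.Sum as Sum
open import Data.Unit using (tt)
import Data.Vec.Properties as Vec
open import Function using (id; _∘′_)
open import Relation.Binary.PropositionalEquality using (_≡_; refl; sym; trans; cong; cong₂; subst)
open import Relation.Nullary using (¬_; Dec; does; yes; no)
open import Defs

-- Replacing a variable by itself.

if-same : ∀ {z x : Var} (z≟x : Dec (z ≡ x)) → (if does z≟x then x else z) ≡ z
if-same (yes z≡x) = sym z≡x
if-same (no _)    = refl

-- With `y` taken to be `x`, this turns `∃-I` into `A ⊃ (∃[ x ] A)`, which the stability of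
-- existential problems rests on.
[x/x]-id : ∀ {L} x (A : Formula L) → A [ x / x ] ≡ A
[x/x]-id-under : ∀ {L} z x (A : Formula L) → (if does (z ≟ x) then A else A [ x / x ]) ≡ A

[x/x]-id x (atom i zs) = cong (atom i) (trans (Vec.map-cong (λ z → if-same (z ≟ x)) zs) (Vec.map-id zs))
[x/x]-id x falsum      = refl
[x/x]-id x (A ∧ B)     = cong₂ _∧_ ([x/x]-id x A) ([x/x]-id x B)
[x/x]-id x (A ∨ B)     = cong₂ _∨_ ([x/x]-id x A) ([x/x]-id x B)
[x/x]-id x (A ⊃ B)     = cong₂ _⊃_ ([x/x]-id x A) ([x/x]-id x B)
[x/x]-id x (∀[ z ] A)  = cong (∀[ z ]_) ([x/x]-id-under z x A)
[x/x]-id x (∃[ z ] A)  = cong (∃[ z ]_) ([x/x]-id-under z x A)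
[x/x]-id x (□ A)       = cong □_ ([x/x]-id x A)
[x/x]-id x (! A)       = cong !_ ([x/x]-id x A)
[x/x]-id x (¿ A)       = cong ¿_ ([x/x]-id x A)

[x/x]-id-under z x A with does (z ≟ x)
... | true  = refl
... | false = [x/x]-id x A

-- A quantifier on `x` itself does no harm, as `x` is not free in the formula it heads.
FreeFor-refl : ∀ {L} x (A : Formula L) → FreeFor x x A
FreeFor-refl x (atom _ _) = tt
FreeFor-refl x falsum     = tt
FreeFor-refl x (A ∧ B)    = FreeFor-refl x A , FreeFor-refl x B
FreeFor-refl x (A ∨ B)    = FreeFor-refl x A , FreeFor-refl x B
FreeFor-refl x (A ⊃ B)    = FreeFor-refl x A , FreeFor-refl x B
FreeFor-refl x (∀[ z ] A) with x ≟ z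
... | yes x≡z = inj₁ λ (x≢z , _) → x≢z x≡z
... | no x≢z  = inj₂ (x≢z , FreeFor-refl x A)
FreeFor-refl x (∃[ z ] A) with x ≟ z
... | yes x≡z = inj₁ λ (x≢z , _) → x≢z x≡z
... | no x≢z  = inj₂ (x≢z , FreeFor-refl x A)
FreeFor-refl x (□ A)      = FreeFor-refl x A
FreeFor-refl x (! A)      = FreeFor-refl x A
FreeFor-refl x (¿ A)      = FreeFor-refl x A

-- Theories with an S4 modality.

record S4Theory (L : Lang) : Set₁ where
  infix 4 ⊢_
  infixr 30 ■_
  field
    ⊢_        : Formula L → Set
    ⊢-axiom   : ∀ {A} → ClassicalAxiom A → ⊢ A
    ⊢-mp      : ∀ {A B} → ⊢ A ⊃ B → ⊢ A → ⊢ B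
    ⊢-∀-intro : ∀ {A B x} → ¬ Free x A → ⊢ A ⊃ B → ⊢ A ⊃ (∀[ x ] B)
    ⊢-∃-elim  : ∀ {A B x} → ¬ Free x B → ⊢ A ⊃ B → ⊢ (∃[ x ] A) ⊃ B
    -- `■_` is an arbitrary operation rather than a constructor, so that it may be the identity; its
    -- compatibility with variables and substitution therefore has to be assumed.
    ■_        : Formula L → Formula L
    ■-Free    : ∀ {x} A → Free x (■ A) → Free x A
    ■-FreeFor : ∀ {x y} A → FreeFor y x A → FreeFor y x (■ A)
    ■-[/]     : ∀ {x y} A → (■ A) [ y / x ] ≡ ■ (A [ y / x ])
    ■-T       : ∀ {A} → ⊢ ■ A ⊃ A
    ■-4       : ∀ {A} → ⊢ ■ A ⊃ ■ ■ A
    ■-K       : ∀ {A B} → ⊢ ■ (A ⊃ B) ⊃ ■ A ⊃ ■ B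
    ■-nec     : ∀ {A} → ⊢ A → ⊢ ■ A

module Translation {L : Lang} (T : S4Theory L) where
  open S4Theory T

  -- Hilbert-style derivations in S4.

  infixr 9 _⊙_

  int-axiom : ∀ {A} → IntuitionisticAxiom A → ⊢ A
  int-axiom a = ⊢-axiom (int a)

  ⊃-const : ∀ {A B} → ⊢ B → ⊢ A ⊃ B
  ⊃-const = ⊢-mp (int-axiom ⊃-K)

  -- The antecedent `A` serves as a context: `⊃-ap` applies within it, the projections read
  -- hypotheses off it, and `⊃-curry` discharges the last one.
  ⊃-ap : ∀ {A B C} → ⊢ A ⊃ B ⊃ C → ⊢ A ⊃ B → ⊢ A ⊃ C
  ⊃-ap f g = ⊢-mp (⊢-mp (int-axiom ⊃-S) f) g

  ⊃-refl : ∀ {A} → ⊢ A ⊃ A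
  ⊃-refl {A} = ⊃-ap (int-axiom ⊃-K) (int-axiom (⊃-K {B = A}))

  _⊙_ : ∀ {A B C} → ⊢ B ⊃ C → ⊢ A ⊃ B → ⊢ A ⊃ C
  f ⊙ g = ⊃-ap (⊃-const f) g

  ∧-proj₁ : ∀ {A B} → ⊢ A ∧ B ⊃ A
  ∧-proj₁ = int-axiom ∧-E₁

  ∧-proj₂ : ∀ {A B} → ⊢ A ∧ B ⊃ B
  ∧-proj₂ = int-axiom ∧-E₂

  ∧-pair : ∀ {A B C} → ⊢ A ⊃ B → ⊢ A ⊃ C → ⊢ A ⊃ B ∧ C
  ∧-pair f g = ⊃-ap (int-axiom ∧-I ⊙ f) g

  ∨-case : ∀ {A B C} → ⊢ A ⊃ C → ⊢ B ⊃ C → ⊢ A ∨ B ⊃ C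
  ∨-case f g = ⊢-mp (⊢-mp (int-axiom ∨-E) f) g

  ⊃-curry : ∀ {A B C} → ⊢ A ∧ B ⊃ C → ⊢ A ⊃ B ⊃ C
  ⊃-curry f = ⊢-mp (int-axiom ⊃-S) (⊃-const f) ⊙ int-axiom ∧-I

  ⇔-refl : ∀ {A} → ⊢ A ⇔ A
  ⇔-refl = ⊢-mp (⊢-mp (int-axiom ∧-I) ⊃-refl) ⊃-refl

  ∃-unit : ∀ {x A} → ⊢ A ⊃ (∃[ x ] A)
  ∃-unit {x} {A} = subst (λ B → ⊢ B ⊃ (∃[ x ] A)) ([x/x]-id x A) (int-axiom (∃-I (FreeFor-refl x A)))

  ■-mono : ∀ {A B} → ⊢ A ⊃ B → ⊢ ■ A ⊃ ■ B
  ■-mono f = ⊢-mp ■-K (■-nec f)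

  ■-ap : ∀ {A B C} → ⊢ A ⊃ ■ (B ⊃ C) → ⊢ A ⊃ B → ⊢ A ⊃ C
  ■-ap f g = ⊃-ap (■-T ⊙ f) g

  -- Introduction of strict implication: the hypothesis `B` may be discharged under a box because
  -- the remaining context `A` implies its own box.
  ■-curry : ∀ {A B C} → ⊢ A ⊃ ■ A → ⊢ A ∧ B ⊃ C → ⊢ A ⊃ ■ (B ⊃ C)
  ■-curry A⊃■A f = ■-mono (⊃-curry f) ⊙ A⊃■A

  -- The translation, its free variables and substitution.

  ⟦_⟧ : ∀ {s} → Formula (qhc s) → Formula L
  -- This clause comes first to make ⟦_⟧ split on the formula before the sort.
  ⟦ falsum ⟧                    = falsum
  ⟦_⟧ {proposition} (atom i xs) = atom i xs
  ⟦_⟧ {problem}     (atom i xs) = ■ atom i xs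
  ⟦ A ∧ B ⟧                     = ⟦ A ⟧ ∧ ⟦ B ⟧
  ⟦ A ∨ B ⟧                     = ⟦ A ⟧ ∨ ⟦ B ⟧
  ⟦_⟧ {proposition} (A ⊃ B)     = ⟦ A ⟧ ⊃ ⟦ B ⟧
  ⟦_⟧ {problem}     (A ⊃ B)     = ■ (⟦ A ⟧ ⊃ ⟦ B ⟧)
  ⟦_⟧ {proposition} (∀[ x ] A)  = ∀[ x ] ⟦ A ⟧
  ⟦_⟧ {problem}     (∀[ x ] A)  = ■ (∀[ x ] ⟦ A ⟧)
  ⟦ ∃[ x ] A ⟧                  = ∃[ x ] ⟦ A ⟧
  ⟦ ! p ⟧                       = ■ ⟦ p ⟧
  ⟦ ¿ α ⟧                       = ⟦ α ⟧

  -- One inclusion suffices, since the side conditions of rules and axioms only ask that variables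
  -- not be free.
  ⟦⟧-Free : ∀ {s x} (A : Formula (qhc s)) → Free x ⟦ A ⟧ → Free x A
  ⟦⟧-Free {proposition} (atom i xs) = id
  ⟦⟧-Free {problem}     (atom i xs) = ■-Free (atom i xs)
  ⟦⟧-Free falsum                    = id
  ⟦⟧-Free (A ∧ B)                   = Sum.map (⟦⟧-Free A) (⟦⟧-Free B)
  ⟦⟧-Free (A ∨ B)                   = Sum.map (⟦⟧-Free A) (⟦⟧-Free B)
  ⟦⟧-Free {proposition} (A ⊃ B)     = Sum.map (⟦⟧-Free A) (⟦⟧-Free B)
  ⟦⟧-Free {problem}     (A ⊃ B)     = Sum.map (⟦⟧-Free A) (⟦⟧-Free B) ∘′ ■-Free (⟦ A ⟧ ⊃ ⟦ B ⟧)
  ⟦⟧-Free {proposition} (∀[ z ] A)  = Product.map₂ (⟦⟧-Free A)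
  ⟦⟧-Free {problem}     (∀[ z ] A)  = Product.map₂ (⟦⟧-Free A) ∘′ ■-Free (∀[ z ] ⟦ A ⟧)
  ⟦⟧-Free (∃[ z ] A)                = Product.map₂ (⟦⟧-Free A)
  ⟦⟧-Free (! p)                     = ⟦⟧-Free p ∘′ ■-Free ⟦ p ⟧
  ⟦⟧-Free (¿ α)                     = ⟦⟧-Free α

  ⟦⟧-¬Free : ∀ {s x} (A : Formula (qhc s)) → ¬ Free x A → ¬ Free x ⟦ A ⟧
  ⟦⟧-¬Free A ¬free = ¬free ∘′ ⟦⟧-Free A

  ⟦⟧-FreeFor : ∀ {s x y} (A : Formula (qhc s)) → FreeFor y x A → FreeFor y x ⟦ A ⟧
  ⟦⟧-FreeFor {proposition} (atom i xs) = id
  ⟦⟧-FreeFor {problem}     (atom i xs) = ■-FreeFor (atom i xs)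
  ⟦⟧-FreeFor falsum                    = id
  ⟦⟧-FreeFor (A ∧ B)                   = Product.map (⟦⟧-FreeFor A) (⟦⟧-FreeFor B)
  ⟦⟧-FreeFor (A ∨ B)                   = Product.map (⟦⟧-FreeFor A) (⟦⟧-FreeFor B)
  ⟦⟧-FreeFor {proposition} (A ⊃ B)     = Product.map (⟦⟧-FreeFor A) (⟦⟧-FreeFor B)
  ⟦⟧-FreeFor {problem}     (A ⊃ B)     =
    ■-FreeFor (⟦ A ⟧ ⊃ ⟦ B ⟧) ∘′ Product.map (⟦⟧-FreeFor A) (⟦⟧-FreeFor B)
  ⟦⟧-FreeFor {proposition} (∀[ z ] A)  =
    Sum.map (_∘′ Product.map₂ (⟦⟧-Free A)) (Product.map₂ (⟦⟧-FreeFor A))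
  ⟦⟧-FreeFor {problem}     (∀[ z ] A)  =
    ■-FreeFor (∀[ z ] ⟦ A ⟧) ∘′ Sum.map (_∘′ Product.map₂ (⟦⟧-Free A)) (Product.map₂ (⟦⟧-FreeFor A))
  ⟦⟧-FreeFor (∃[ z ] A)                =
    Sum.map (_∘′ Product.map₂ (⟦⟧-Free A)) (Product.map₂ (⟦⟧-FreeFor A))
  ⟦⟧-FreeFor (! p)                     = ■-FreeFor ⟦ p ⟧ ∘′ ⟦⟧-FreeFor p
  ⟦⟧-FreeFor (¿ α)                     = ⟦⟧-FreeFor α

  -- This makes the translated instances of `∀-E` and `∃-I` rest on instances of the same schemas.
  ⟦⟧-[/] : ∀ {s x y} (A : Formula (qhc s)) → ⟦ A [ y / x ] ⟧ ≡ ⟦ A ⟧ [ y / x ]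
  ⟦⟧-[/]-under : ∀ {s x y} z (A : Formula (qhc s)) →
    ⟦ if does (z ≟ x) then A else A [ y / x ] ⟧ ≡ (if does (z ≟ x) then ⟦ A ⟧ else ⟦ A ⟧ [ y / x ])

  ⟦⟧-[/] {proposition} (atom i xs) = refl
  ⟦⟧-[/] {problem}     (atom i xs) = sym (■-[/] (atom i xs))
  ⟦⟧-[/] falsum                    = refl
  ⟦⟧-[/] (A ∧ B)                   = cong₂ _∧_ (⟦⟧-[/] A) (⟦⟧-[/] B)
  ⟦⟧-[/] (A ∨ B)                   = cong₂ _∨_ (⟦⟧-[/] A) (⟦⟧-[/] B)
  ⟦⟧-[/] {proposition} (A ⊃ B)     = cong₂ _⊃_ (⟦⟧-[/] A) (⟦⟧-[/] B)
  ⟦⟧-[/] {problem}     (A ⊃ B)     =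
    trans (cong ■_ (cong₂ _⊃_ (⟦⟧-[/] A) (⟦⟧-[/] B))) (sym (■-[/] (⟦ A ⟧ ⊃ ⟦ B ⟧)))
  ⟦⟧-[/] {proposition} (∀[ z ] A)  = cong (∀[ z ]_) (⟦⟧-[/]-under z A)
  ⟦⟧-[/] {problem}     (∀[ z ] A)  =
    trans (cong (■_ ∘′ ∀[ z ]_) (⟦⟧-[/]-under z A)) (sym (■-[/] (∀[ z ] ⟦ A ⟧)))
  ⟦⟧-[/] (∃[ z ] A)                = cong (∃[ z ]_) (⟦⟧-[/]-under z A)
  ⟦⟧-[/] (! p)                     = trans (cong ■_ (⟦⟧-[/] p)) (sym (■-[/] ⟦ p ⟧))
  ⟦⟧-[/] (¿ α)                     = ⟦⟧-[/] α

  ⟦⟧-[/]-under {x = x} z A =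
    trans (if-float ⟦_⟧ (does (z ≟ x)))
          (cong (if does (z ≟ x) then ⟦ A ⟧ else_) (⟦⟧-[/] A))

  -- Boxed formulas are stable by `■-4`, and conjunction, disjunction and existential quantification
  -- preserve stability because `■_` is monotone and satisfies `■-K`. Implication and universal
  -- quantification do not in general, which is why the translation boxes them.
  stable : (α : Problem) → ⊢ ⟦ α ⟧ ⊃ ■ ⟦ α ⟧
  stable (atom _ _) = ■-4
  stable falsum     = int-axiom ⊥-E
  stable (α ∧ β)    =
    ⊃-ap (■-K ⊙ ■-mono (int-axiom ∧-I) ⊙ stable α ⊙ ∧-proj₁) (stable β ⊙ ∧-proj₂)
  stable (α ∨ β)    =
    ∨-case (■-mono (int-axiom ∨-I₁) ⊙ stable α) (■-mono (int-axiom ∨-I₂) ⊙ stable β)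
  stable (α ⊃ β)    = ■-4
  stable (∀[ x ] α) = ■-4
  stable (∃[ x ] α) =
    -- The consequent is `■ (∃[ x ] ⟦ α ⟧)`, where `x` is bound.
    ⊢-∃-elim (λ free → bound (■-Free (∃[ x ] ⟦ α ⟧) free)) (■-mono ∃-unit ⊙ stable α)
    where
    bound : ¬ Free x (∃[ x ] ⟦ α ⟧)
    bound (x≢x , _) = x≢x refl
  stable (! p)      = ■-4

  -- Soundness of the translation.

  ⟦⟧-classical : ∀ {p : Proposition} → ClassicalAxiom p → ⊢ ⟦ p ⟧
  ⟦⟧-classical lem = ⊢-axiom lem
  ⟦⟧-classical (int ⊃-K) = int-axiom ⊃-K
  ⟦⟧-classical (int ⊃-S) = int-axiom ⊃-S
  ⟦⟧-classical (int ∧-I) = int-axiom ∧-I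
  ⟦⟧-classical (int ∧-E₁) = int-axiom ∧-E₁
  ⟦⟧-classical (int ∧-E₂) = int-axiom ∧-E₂
  ⟦⟧-classical (int ∨-I₁) = int-axiom ∨-I₁
  ⟦⟧-classical (int ∨-I₂) = int-axiom ∨-I₂
  ⟦⟧-classical (int ∨-E) = int-axiom ∨-E
  ⟦⟧-classical (int ⊥-E) = int-axiom ⊥-E
  ⟦⟧-classical (int (∀-E {p} {x} {y} freeFor)) rewrite ⟦⟧-[/] {x = x} {y} p =
    int-axiom (∀-E (⟦⟧-FreeFor p freeFor))
  ⟦⟧-classical (int (∃-I {p} {x} {y} freeFor)) rewrite ⟦⟧-[/] {x = x} {y} p =
    int-axiom (∃-I (⟦⟧-FreeFor p freeFor))

  -- Every implication of a schema is boxed: `■-nec` yields the outermost box and `■-curry` the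
  -- inner ones, at the price of stability of all earlier hypotheses.
  ⟦⟧-intuitionistic : ∀ {α : Problem} → IntuitionisticAxiom α → ⊢ ⟦ α ⟧
  ⟦⟧-intuitionistic (⊃-K {α}) = ■-nec (■-curry (stable α) ∧-proj₁)
  ⟦⟧-intuitionistic (⊃-S {α} {β} {γ}) =
    -- The two hypotheses collected so far form the translation of a single conjunctive problem, so
    -- `stable` covers the whole context.
    ■-nec (■-curry (stable (α ⊃ β ⊃ γ)) (■-curry (stable ((α ⊃ β ⊃ γ) ∧ (α ⊃ β)))
      (■-ap (■-ap (∧-proj₁ ⊙ ∧-proj₁) ∧-proj₂) (■-ap (∧-proj₂ ⊙ ∧-proj₁) ∧-proj₂))))
  ⟦⟧-intuitionistic (∧-I {α}) = ■-nec (■-curry (stable α) ⊃-refl)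
  ⟦⟧-intuitionistic ∧-E₁ = ■-nec ∧-proj₁
  ⟦⟧-intuitionistic ∧-E₂ = ■-nec ∧-proj₂
  ⟦⟧-intuitionistic ∨-I₁ = ■-nec (int-axiom ∨-I₁)
  ⟦⟧-intuitionistic ∨-I₂ = ■-nec (int-axiom ∨-I₂)
  ⟦⟧-intuitionistic (∨-E {α} {β} {γ}) =
    ■-nec (■-curry (stable (α ⊃ γ)) (■-curry (stable ((α ⊃ γ) ∧ (β ⊃ γ)))
      (⊃-ap (⊃-ap (int-axiom ∨-E ⊙ ■-T ⊙ ∧-proj₁ ⊙ ∧-proj₁) (■-T ⊙ ∧-proj₂ ⊙ ∧-proj₁)) ∧-proj₂)))
  ⟦⟧-intuitionistic ⊥-E = ■-nec (int-axiom ⊥-E)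
  ⟦⟧-intuitionistic (∀-E {α} {x} {y} freeFor) rewrite ⟦⟧-[/] {x = x} {y} α =
    ■-nec (int-axiom (∀-E (⟦⟧-FreeFor α freeFor)) ⊙ ■-T)
  ⟦⟧-intuitionistic (∃-I {α} {x} {y} freeFor) rewrite ⟦⟧-[/] {x = x} {y} α =
    ■-nec (int-axiom (∃-I (⟦⟧-FreeFor α freeFor)))

  ⟦⟧-sound : ∀ {Γ} → (∀ {s} {A : Formula (qhc s)} → (s , A) ∈ Γ → ⊢ ⟦ A ⟧) →
             ∀ {s} {A : Formula (qhc s)} → Γ ⊢QHC A → ⊢ ⟦ A ⟧
  ⟦⟧-sound {Γ} ⟦Γ⟧ = sound
    where
    sound : ∀ {s} {A : Formula (qhc s)} → Γ ⊢QHC A → ⊢ ⟦ A ⟧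
    sound (premise A∈Γ) = ⟦Γ⟧ A∈Γ
    sound {proposition} (axiom a) = ⟦⟧-classical a
    sound {problem}     (axiom a) = ⟦⟧-intuitionistic a
    sound {proposition} (mp d e) = ⊢-mp (sound d) (sound e)
    sound {problem}     (mp d e) = ⊢-mp (⊢-mp ■-T (sound d)) (sound e)
    sound {proposition} (∀-intro {A = p} ¬free d) = ⊢-∀-intro (⟦⟧-¬Free p ¬free) (sound d)
    sound {problem}     (∀-intro {A = α} ¬free d) =
      -- The quantifier is introduced below the outer box; the box in front of it then comes from
      -- the stability of `α`.
      ■-nec (■-mono (⊢-∀-intro (⟦⟧-¬Free α ¬free) (⊢-mp ■-T (sound d))) ⊙ stable α)
    sound {proposition} (∃-elim {B = q} ¬free d) = ⊢-∃-elim (⟦⟧-¬Free q ¬free) (sound d)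
    sound {problem}     (∃-elim {B = β} ¬free d) =
      ■-nec (⊢-∃-elim (⟦⟧-¬Free β ¬free) (⊢-mp ■-T (sound d)))
    sound (!-rule d) = ■-nec (sound d)
    sound (?-rule d) = sound d
    sound ?!-E = ■-T
    sound (!?-I {α}) = ■-nec (stable α)
    -- The inner implication is boxed as well, so the hypothesis `■ (p ⊃ q)` must first be doubled
    -- by `■-4`.
    sound !-⊃ = ■-nec (■-mono ■-K ⊙ ■-4)
    sound ?-⊃ = ■-T
    sound !-0 = ■-nec ■-T
    -- As `¿_` is read as the identity and conjunction, disjunction and existential quantification
    -- get no box in either sort, both sides have the same translation.
    sound ?-∧ = ⇔-refl
    sound ?-∨ = ⇔-refl
    sound ?-⊥ = ⊃-refl
    sound ?-∃ = ⇔-refl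
    sound ?-∀ = ■-T

  -- Soundness carries the derivation over to the theory, and since the translation undoes `f`, its
  -- premises and conclusion become the original formulas.
  ⟦⟧-conservative : (f : Formula L → Proposition) → (∀ A → ⟦ f A ⟧ ≡ A) →
                    ∀ As → (∀ {A} → A ∈ As → ⊢ A) →
                    ∀ A → propositions (map f As) ⊢QHC f A → ⊢ A
  ⟦⟧-conservative f ⟦f⟧≡id As ⊢As A d = subst ⊢_ (⟦f⟧≡id A) (⟦⟧-sound premises d)
    where
    premises : ∀ {s} {B : Formula (qhc s)} → (s , B) ∈ propositions (map f As) → ⊢ ⟦ B ⟧
    premises B∈ with ∈-map⁻ (proposition ,_) B∈
    ... | _ , p∈ , refl with ∈-map⁻ f p∈
    ...   | C , C∈As , refl = subst ⊢_ (sym (⟦f⟧≡id C)) (⊢As C∈As)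

-- The two instances: QC with a trivial modality, and QS4.

qcTheory : List (Formula qc) → S4Theory qc
qcTheory Γ = record
  { ⊢_        = Γ ⊢QC_
  ; ⊢-axiom   = axiom
  ; ⊢-mp      = mp
  ; ⊢-∀-intro = ∀-intro
  ; ⊢-∃-elim  = ∃-elim
  -- With the identity as modality, the laws T, 4 and K all become instances of `A ⊃ A`, and
  -- necessitation is trivial.
  ; ■_        = id
  ; ■-Free    = λ _ → id
  ; ■-FreeFor = λ _ → id
  ; ■-[/]     = λ _ → refl
  ; ■-T       = ⊃-identity
  ; ■-4       = ⊃-identity
  ; ■-K       = ⊃-identity
  ; ■-nec     = id
  }
  where
  ⊃-identity : ∀ {A} → Γ ⊢QC A ⊃ A
  ⊃-identity {A} = mp (mp (axiom (int ⊃-S)) (axiom (int ⊃-K))) (axiom (int (⊃-K {B = A})))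

qs4Theory : List (Formula qs4) → S4Theory qs4
qs4Theory Γ = record
  { ⊢_        = Γ ⊢QS4_
  ; ⊢-axiom   = axiom
  ; ⊢-mp      = mp
  ; ⊢-∀-intro = ∀-intro
  ; ⊢-∃-elim  = ∃-elim
  ; ■_        = □_
  ; ■-Free    = λ _ → id
  ; ■-FreeFor = λ _ → id
  ; ■-[/]     = λ _ → refl
  ; ■-T       = □-T
  ; ■-4       = □-4
  ; ■-K       = □-K
  ; ■-nec     = nec
  }

⟦°⟧-id : ∀ Γ (p : Formula qc) → let open Translation (qcTheory Γ) in ⟦ p ° ⟧ ≡ p
⟦°⟧-id Γ (atom i xs) = refl
⟦°⟧-id Γ falsum      = refl
⟦°⟧-id Γ (p ∧ q)     = cong₂ _∧_ (⟦°⟧-id Γ p) (⟦°⟧-id Γ q)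
⟦°⟧-id Γ (p ∨ q)     = cong₂ _∨_ (⟦°⟧-id Γ p) (⟦°⟧-id Γ q)
⟦°⟧-id Γ (p ⊃ q)     = cong₂ _⊃_ (⟦°⟧-id Γ p) (⟦°⟧-id Γ q)
⟦°⟧-id Γ (∀[ x ] p)  = cong (∀[ x ]_) (⟦°⟧-id Γ p)
⟦°⟧-id Γ (∃[ x ] p)  = cong (∃[ x ]_) (⟦°⟧-id Γ p)

⟦*⟧-id : ∀ Γ (A : Formula qs4) → let open Translation (qs4Theory Γ) in ⟦ A * ⟧ ≡ A
⟦*⟧-id Γ (atom i xs) = refl
⟦*⟧-id Γ falsum      = refl
⟦*⟧-id Γ (A ∧ B)     = cong₂ _∧_ (⟦*⟧-id Γ A) (⟦*⟧-id Γ B)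
⟦*⟧-id Γ (A ∨ B)     = cong₂ _∨_ (⟦*⟧-id Γ A) (⟦*⟧-id Γ B)
⟦*⟧-id Γ (A ⊃ B)     = cong₂ _⊃_ (⟦*⟧-id Γ A) (⟦*⟧-id Γ B)
⟦*⟧-id Γ (∀[ x ] A)  = cong (∀[ x ]_) (⟦*⟧-id Γ A)
⟦*⟧-id Γ (∃[ x ] A)  = cong (∃[ x ]_) (⟦*⟧-id Γ A)
-- In `¿ ! (A *)` the `!_` becomes `□_` and the `¿_` disappears.
⟦*⟧-id Γ (□ A)       = cong □_ (⟦*⟧-id Γ A)

theorem3p2 : (∀ (ps : List (Formula qc)) (p : Formula qc) →
    propositions (map _° ps) ⊢QHC p ° → ps ⊢QC p)
    ×
    (∀ (As : List (Formula qs4)) (A : Formula qs4) →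
    propositions (map _* As) ⊢QHC A * → As ⊢QS4 A)
theorem3p2 =
  (λ ps → Translation.⟦⟧-conservative (qcTheory ps) _° (⟦°⟧-id ps) ps premise) ,
  (λ As → Translation.⟦⟧-conservative (qs4Theory As) _* (⟦*⟧-id As) As premise)
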